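{- Let $m,n\ge 1$, let $\mathbf r=(r_1,\dots,r_m)$ and $\mathbf c=(c_1,\dots,c_n)$ be vectors of strictly positive integers with $\sum_{i=1}^m r_i=\sum_{j=1}^n c_j$, and let $k,l\in\{1,\dots,m\}$. Then the boolean formula $F_{k,l}(\mathbf r,\mathbf c)$ (defined in the context) is satisfiable if and only if $(\mathbf r,\mathbf c)$ has a realization $T\subseteq\{1,\dots,m\}\times\{1,\dots,n\}$ that is an hv-convex polyomino anchored at $(k,l)$.
   Context: An object is a subset $T$ of the cells of the grid $\{1,\dots,m\}\times\{1,\dots,n\}$, where $(i,j)$ is the cell in row $i$ and column $j$; it is identified with an $m\times n$ 0-1 matrix ($T_{i,j}=1$ iff $(i,j)\in T$). $T$ is a realization of $(\mathbf r,\mathbf c)$ if $\sum_j T_{i,j}=r_i$ for all $i$ and $\sum_i T_{i,j}=c_j$ for all $j$. $T$ is a polyomino if the graph whose vertices are the cells of $T$, with $(i,j)$ and $(i',j')$ adjacent iff $|i-i'|+|j-j'|\le 1$, is connected. $T$ is h-convex if $(i,p),(i,q)\in T$ implies $(i,j)\in T$ for all $p\le j\le q$; v-convexity is defined analogously for columns; $T$ is hv-convex if it is both. An hv-convex polyomino $T$ is anchored at $(k,l)$ if $(k,1)\in T$ and $(l,n)\in T$. The formula $F_{k,l}(\mathbf r,\mathbf c)$ has boolean variables $A_{i,j},B_{i,j},C_{i,j},D_{i,j}$ for $1\le i\le m$, $1\le j\le n$. A bar denotes negation. Any of the symbols $A_{i,j},B_{i,j},C_{i,j},D_{i,j}$ with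 $(i,j)\notin\{1,\dots,m\}\times\{1,\dots,n\}$ denotes the constant 1 (true), so its negation is false. Define $F_{k,l}(\mathbf r,\mathbf c)=\mathit{Cor}\wedge\mathit{Dis}\wedge\mathit{Con}\wedge\mathit{Anc}\wedge\mathit{LBC}\wedge\mathit{UBR}$, where the following are conjunctions of the listed clauses, with $i$ ranging over $\{1,\dots,m\}$ (subject to any stated restriction) and $j$ over $\{1,\dots,n\}$: - $\mathit{Cor}$: for all $i,j$: $A_{i,j}\Rightarrow A_{i-1,j}$, $A_{i,j}\Rightarrow A_{i,j-1}$, $B_{i,j}\Rightarrow B_{i-1,j}$, $B_{i,j}\Rightarrow B_{i,j+1}$, $C_{i,j}\Rightarrow C_{i+1,j}$, $C_{i,j}\Rightarrow C_{i,j-1}$, $D_{i,j}\Rightarrow D_{i+1,j}$, $D_{i,j}\Rightarrow D_{i,j+1}$. - $\mathit{Dis}$: for all $i,j$ and all distinct symbols $X,Y\in\{A,B,C,D\}$: $X_{i,j}\Rightarrow\overline{Y}_{i,j}$. - $\mathit{Con}$: for all $i,j$: $A_{i,j}\Rightarrow\overline{D}_{i+1,j+1}$ and $B_{i,j}\Rightarrow\overline{C}_{i+1,j-1}$. - $\mathit{Anc}$: $\overline{A}_{k,1}\wedge\overline{B}_{k,1}\wedge\overline{C}_{k,1}\wedge\overline{D}_{k,1}\wedge\overline{A}_{l,n}\wedge\overline{B}_{l,n}\wedge\overline{C}_{l,n}\wedge\overline{D}_{l,n}$. - $\mathit{LBC}$: for all $i,j$: $A_{i,j}\Rightarrow\overline{C}_{i+c_j,j}$,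 $A_{i,j}\Rightarrow\overline{D}_{i+c_j,j}$, $B_{i,j}\Rightarrow\overline{C}_{i+c_j,j}$, $B_{i,j}\Rightarrow\overline{D}_{i+c_j,j}$; and for all $j$: $\overline{C}_{c_j,j}$ and $\overline{D}_{c_j,j}$. - $\mathit{UBR}$: for all $j$: $\overline{A}_{i,j}\Rightarrow B_{i,j+r_i}$ for all $i\le\min\{k,l\}$; $\overline{C}_{i,j}\Rightarrow B_{i,j+r_i}$ for all $i$ with $k\le i\le l$; $\overline{A}_{i,j}\Rightarrow D_{i,j+r_i}$ for all $i$ with $l\le i\le k$; $\overline{C}_{i,j}\Rightarrow D_{i,j+r_i}$ for all $i\ge\max\{k,l\}$. -}

module Defs where

import Algebra.Properties.CommutativeMonoid.Sum
open import Data.Bool.Base using (Bool; true; false; not; if_then_else_) renaming (_∧_ to _and_; _∨_ to _or_)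
open import Data.Fin.Base as Fin using (Fin; zero; suc; toℕ; fromℕ; fromℕ<)
open import Data.Fin.Patterns using (0F; 1F; 2F; 3F)
import Data.Fin.Properties as Fin
open import Data.List.Base using (List; map; filter; foldr; allFin)
open import Data.Maybe.Base using (Maybe; just; nothing)
open import Data.Nat.Base using (ℕ; zero; suc; _+_; _∸_; _≤_; _⊓_; _⊔_; ∣_-_∣; NonZero)
open import Data.Nat.Properties using (_≤?_; _<?_; +-0-commutativeMonoid)
open import Data.Product.Base using (Σ; ∃; _×_; _,_; proj₁)
open import Data.Vec.Functional using (Vector)
open import Function.Base using (_on_)
open import Relation.Binary.Construct.Closure.ReflexiveTransitive using (Star)
open import Relation.Binary.PropositionalEquality using (_≡_)
open import Relation.Nullary.Decidable using (yes; no; ¬?; _×-dec_)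

open Algebra.Properties.CommutativeMonoid.Sum +-0-commutativeMonoid public using (sum)

------------------------------------------------------------------------
-- Subsets of the grid

Cell : ℕ → ℕ → Set
Cell m n = Fin m × Fin n

Object : ℕ → ℕ → Set
Object m n = Fin m → Fin n → Bool

infix 4 _∈_

_∈_ : ∀ {m n} → Cell m n → Object m n → Set
(i , j) ∈ T = T i j ≡ true

bit : Bool → ℕ
bit b = if b then 1 else 0

IsRealization : ∀ {m n} → Vector ℕ m → Vector ℕ n → Object m n → Set
IsRealization r c T =
  (∀ i → sum (λ j → bit (T i j)) ≡ r i) × (∀ j → sum (λ i → bit (T i j)) ≡ c j)

Adjacent : ∀ {m n} → Cell m n → Cell m n → Set
Adjacent (i , j) (i′ , j′) = ∣ toℕ i - toℕ i′ ∣ + ∣ toℕ j - toℕ j′ ∣ ≤ 1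

Vertex : ∀ {m n} → Object m n → Set
Vertex {m} {n} T = Σ (Cell m n) (_∈ T)

-- The empty object is not excluded; it is never a realization of
-- strictly positive vectors.
IsPolyomino : ∀ {m n} → Object m n → Set
IsPolyomino T = (u v : Vertex T) → Star (Adjacent on proj₁) u v

HConvex : ∀ {m n} → Object m n → Set
HConvex T = ∀ i p j q → (i , p) ∈ T → (i , q) ∈ T → p Fin.≤ j → j Fin.≤ q → (i , j) ∈ T

VConvex : ∀ {m n} → Object m n → Set
VConvex T = ∀ j p i q → (p , j) ∈ T → (q , j) ∈ T → p Fin.≤ i → i Fin.≤ q → (i , j) ∈ T

HVConvex : ∀ {m n} → Object m n → Set
HVConvex T = HConvex T × VConvex T

first last : ∀ {n} .{{_ : NonZero n}} → Fin n
first {suc n} = zero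
last  {suc n} = fromℕ n

Anchored : ∀ {m n} .{{_ : NonZero n}} → Fin m → Fin m → Object m n → Set
Anchored k l T = (k , first) ∈ T × (l , last) ∈ T

------------------------------------------------------------------------
-- Boolean formulas

infix  9 ¬_
infixr 6 _∧_
infixr 5 _⇒_

data Formula (V : Set) : Set where
  var : V → Formula V
  ⊤   : Formula V
  ¬_  : Formula V → Formula V
  _∧_ : Formula V → Formula V → Formula V
  _⇒_ : Formula V → Formula V → Formula V

⋀ : ∀ {V} → List (Formula V) → Formula V
⋀ = foldr _∧_ ⊤

⋀[_] : ∀ {V} {I : Set} → List I → (I → Formula V) → Formula V
⋀[ is ] φ = ⋀ (map φ is)


eval : ∀ {V} → (V → Bool) → Formula V → Bool
eval ν (var x) = ν x
eval ν ⊤       = true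
eval ν (¬ φ)   = not (eval ν φ)
eval ν (φ ∧ ψ) = eval ν φ and eval ν ψ
eval ν (φ ⇒ ψ) = not (eval ν φ) or eval ν ψ

Satisfiable : ∀ {V} → Formula V → Set
Satisfiable {V} φ = ∃ λ (ν : V → Bool) → eval ν φ ≡ true

------------------------------------------------------------------------
-- The formula F

Symbol : Set
Symbol = Fin 4

pattern A = 0F
pattern B = 1F
pattern C = 2F
pattern D = 3F

-- `Fin` counts from 0, whereas the indices in the clauses count from 1;
-- since no index in a clause is below 0, natural numbers suffice, and
-- 0 is the out-of-range index reached by `∸ 1`.
pos : ∀ {m} → Fin m → ℕ
pos i = suc (toℕ i)

unpos : ∀ m → ℕ → Maybe (Fin m)
unpos m zero = nothing
unpos m (suc i) with i <? m
... | yes i<m = just (fromℕ< i<m)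
... | no  _   = nothing

module _ {m n : ℕ} where

  Var : Set
  Var = Symbol × Cell m n

  infix 10 _[_,_]

  _[_,_] : Symbol → ℕ → ℕ → Formula Var
  X [ i , j ] with unpos m i | unpos n j
  ... | just i′ | just j′ = var (X , i′ , j′)
  ... | _       | _       = ⊤

  ∀cells : (Fin m → Fin n → Formula Var) → Formula Var
  ∀cells φ = ⋀[ allFin m ] λ i → ⋀[ allFin n ] λ j → φ i j

  Cor : Formula Var
  Cor = ∀cells λ i′ j′ → let i = pos i′; j = pos j′ in
      (A [ i , j ] ⇒ A [ i ∸ 1 , j ]) ∧ (A [ i , j ] ⇒ A [ i , j ∸ 1 ])
    ∧ (B [ i , j ] ⇒ B [ i ∸ 1 , j ]) ∧ (B [ i , j ] ⇒ B [ i , j + 1 ])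
    ∧ (C [ i , j ] ⇒ C [ i + 1 , j ]) ∧ (C [ i , j ] ⇒ C [ i , j ∸ 1 ])
    ∧ (D [ i , j ] ⇒ D [ i + 1 , j ]) ∧ (D [ i , j ] ⇒ D [ i , j + 1 ])

  Dis : Formula Var
  Dis = ∀cells λ i′ j′ → let i = pos i′; j = pos j′ in
    ⋀[ allFin 4 ] λ X → ⋀[ filter (λ Y → ¬? (X Fin.≟ Y)) (allFin 4) ] λ Y →
      X [ i , j ] ⇒ ¬ Y [ i , j ]

  Con : Formula Var
  Con = ∀cells λ i′ j′ → let i = pos i′; j = pos j′ in
      (A [ i , j ] ⇒ ¬ D [ i + 1 , j + 1 ])
    ∧ (B [ i , j ] ⇒ ¬ C [ i + 1 , j ∸ 1 ])

  Anc : Fin m → Fin m → Formula Var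
  Anc k′ l′ = let k = pos k′; l = pos l′ in
      ¬ A [ k , 1 ] ∧ ¬ B [ k , 1 ] ∧ ¬ C [ k , 1 ] ∧ ¬ D [ k , 1 ]
    ∧ ¬ A [ l , n ] ∧ ¬ B [ l , n ] ∧ ¬ C [ l , n ] ∧ ¬ D [ l , n ]

  LBC : Vector ℕ n → Formula Var
  LBC c =
      (∀cells λ i′ j′ → let i = pos i′; j = pos j′ in
          (A [ i , j ] ⇒ ¬ C [ i + c j′ , j ])
        ∧ (A [ i , j ] ⇒ ¬ D [ i + c j′ , j ])
        ∧ (B [ i , j ] ⇒ ¬ C [ i + c j′ , j ])
        ∧ (B [ i , j ] ⇒ ¬ D [ i + c j′ , j ]))
    ∧ (⋀[ allFin n ] λ j′ → let j = pos j′ in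
          ¬ C [ c j′ , j ] ∧ ¬ D [ c j′ , j ])

  UBR : Fin m → Fin m → Vector ℕ m → Formula Var
  UBR k′ l′ r = let k = pos k′; l = pos l′ in
    ⋀[ allFin n ] λ j′ → let j = pos j′ in
        (⋀[ filter (λ i′ → pos i′ ≤? k ⊓ l) (allFin m) ] λ i′ → let i = pos i′ in
          ¬ A [ i , j ] ⇒ B [ i , j + r i′ ])
      ∧ (⋀[ filter (λ i′ → k ≤? pos i′ ×-dec pos i′ ≤? l) (allFin m) ] λ i′ → let i = pos i′ in
          ¬ C [ i , j ] ⇒ B [ i , j + r i′ ])
      ∧ (⋀[ filter (λ i′ → l ≤? pos i′ ×-dec pos i′ ≤? k) (allFin m) ] λ i′ → let i = pos i′ in
          ¬ A [ i , j ] ⇒ D [ i , j + r i′ ])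
      ∧ (⋀[ filter (λ i′ → k ⊔ l ≤? pos i′) (allFin m) ] λ i′ → let i = pos i′ in
          ¬ C [ i , j ] ⇒ D [ i , j + r i′ ])

  F : Fin m → Fin m → Vector ℕ m → Vector ℕ n → Formula Var
  F k l r c = Cor ∧ Dis ∧ Con ∧ Anc k l ∧ LBC c ∧ UBR k l r

{-# OPTIONS --safe #-}
module Submission where

-- From a satisfying valuation, T is the set of cells marked by none of A, B, C, D.  LBC makes
-- each column sum at least c j and UBR makes each row sum at most r i; as the totals agree, all
-- these inequalities are equalities.  Con forces consecutive columns, which are nonempty
-- intervals, to share a row, so T is connected.
--
-- Conversely, given T, mark (i , j) with the corner symbol telling on which side the cells of T
-- in row i and in column j lie.  The key fact is that a marked cell has no cell of T in its
-- outer quadrant: T restricted to that quadrant is closed under adjacency, while row i contains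
-- a cell of T outside it.

open import Defs
import Algebra.Properties.CommutativeMonoid.Sum as Sum
import Axiom.UniquenessOfIdentityProofs
open import Data.Bool.Base using (Bool; true; false)
import Data.Bool.Properties as Bool
open import Data.Fin.Base as Fin using (Fin; zero; suc; toℕ; fromℕ<)
import Data.Fin.Properties as Fin
open import Data.List.Base using (List; []; _∷_; allFin; filter)
open import Data.List.Membership.Propositional renaming (_∈_ to _∈ˡ_)
open import Data.List.Membership.Propositional.Properties using (∈-allFin; ∈-filter⁺; ∈-filter⁻)
open import Data.List.Relation.Unary.Any using (here; there)
open import Data.Maybe.Base using (just; nothing)
open import Data.Nat.Base
  using (ℕ; zero; suc; _+_; _∸_; _≤_; _<_; _>_; _⊓_; _⊔_; ∣_-_∣; NonZero; z≤n; s≤s)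
open import Data.Nat.Properties
open import Data.Product.Base using (∃; ∃₂; _×_; _,_; proj₁; proj₂)
open import Data.Sum.Base using (_⊎_; inj₁; inj₂; swap)
open import Data.Unit.Base using (tt) renaming (⊤ to Unit)
open import Data.Vec.Functional using (Vector)
open import Function.Base using (_∘_; _on_; id; case_of_)
open import Function.Bundles using (_⇔_; mk⇔)
open import Relation.Binary.Construct.Closure.ReflexiveTransitive
  using (Star; ε; _◅_; _◅◅_; reverse)
open import Relation.Binary.PropositionalEquality
  using (_≡_; _≢_; refl; sym; trans; cong; subst; subst₂)
open import Relation.Nullary.Decidable
  using (Dec; yes; no; does; dec-true; _×-dec_; _⊎-dec_; _→-dec_)
open import Relation.Nullary.Negation.Core using (contradiction) renaming (¬_ to Not)

open Sum +-0-commutativeMonoid using (∑-comm)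

module UIP = Axiom.UniquenessOfIdentityProofs.Decidable⇒UIP

does⇒ : {P : Set} (P? : Dec P) → does P? ≡ true → P
does⇒ (yes p) _ = p

index : ∀ {n k} → k < n → ∃ λ (i : Fin n) → toℕ i ≡ k
index k<n = fromℕ< k<n , Fin.toℕ-fromℕ< k<n

next : ∀ {n} {x y : Fin n} → x Fin.< y → ∃ λ (z : Fin n) → toℕ z ≡ suc (toℕ x)
next {y = y} x<y = index (≤-<-trans x<y (Fin.toℕ<n y))

previous : ∀ {n} {x y : Fin n} → x Fin.< y → ∃ λ (z : Fin n) → toℕ y ≡ suc (toℕ z)
previous {x = x} {y = suc y} _ = Fin.inject₁ y , cong suc (sym (Fin.toℕ-inject₁ y))

walk : ∀ {n} (P : Fin n → Set) → (∀ {x y} → toℕ y ≡ suc (toℕ x) → P x → P y) →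
       ∀ {x y} → x Fin.≤ y → P x → P y
walk P step {zero}  {zero}  _ p = p
walk {suc (suc _)} P step {zero} {suc y} _ p =
  walk (P ∘ suc) (step ∘ cong suc) {zero} {y} z≤n (step refl p)
walk P step {suc x} {suc y} (s≤s x≤y) p = walk (P ∘ suc) (step ∘ cong suc) x≤y p

walk⁻ : ∀ {n} (P : Fin n → Set) → (∀ {x y} → toℕ y ≡ suc (toℕ x) → P y → P x) →
        ∀ {x y} → x Fin.≤ y → P y → P x
walk⁻ P step {x} x≤y = walk (λ z → P z → P x) (λ e f → f ∘ step e) x≤y id

threshold : ∀ {n} {P : Fin n → Set} → (∀ i → Dec (P i)) →
            (∀ {i j} → i Fin.≤ j → P j → P i) →
            ∃ λ a → a ≤ n × (∀ i → toℕ i < a → P i) × (∀ i → P i → toℕ i < a)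
threshold {zero} P? closed = 0 , z≤n , (λ ()) , λ ()
threshold {suc n} P? closed with P? zero
... | no ¬p = 0 , z≤n , (λ _ ()) , λ i p → contradiction (closed z≤n p) ¬p
... | yes p with threshold (P? ∘ suc) (closed ∘ s≤s)
... | a , a≤n , below , above = suc a , s≤s a≤n , below′ , above′
  where
  below′ : ∀ i → toℕ i < suc a → _
  below′ zero    _         = p
  below′ (suc i) (s≤s i<a) = below i i<a
  above′ : ∀ i → _ → toℕ i < suc a
  above′ zero    _ = s≤s z≤n
  above′ (suc i) q = s≤s (above i q)

sum-mono : ∀ {n} {f g : Vector ℕ n} → (∀ i → f i ≤ g i) → sum f ≤ sum g
sum-mono {zero}  f≤g = z≤n
sum-mono {suc n} f≤g = +-mono-≤ (f≤g zero) (sum-mono (f≤g ∘ suc))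

sum-squeeze : ∀ {n} {f g : Vector ℕ n} → (∀ i → f i ≤ g i) → sum g ≤ sum f → ∀ i → f i ≡ g i
sum-squeeze {suc n} {f} {g} f≤g Σg≤Σf zero =
  ≤-antisym (f≤g zero)
    (+-cancelʳ-≤ (sum (g ∘ suc)) (g zero) (f zero)
      (≤-trans Σg≤Σf (+-monoʳ-≤ (f zero) (sum-mono (f≤g ∘ suc)))))
sum-squeeze {suc n} {f} {g} f≤g Σg≤Σf (suc i) =
  sum-squeeze (f≤g ∘ suc)
    (+-cancelˡ-≤ (f zero) (sum (g ∘ suc)) (sum (f ∘ suc))
      (≤-trans (+-monoˡ-≤ (sum (g ∘ suc)) (f≤g zero)) Σg≤Σf)) i

count : ∀ {n} → (Fin n → Bool) → ℕ
count f = sum (bit ∘ f)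

bit≤1 : ∀ b → bit b ≤ 1
bit≤1 false = z≤n
bit≤1 true  = ≤-refl

count≤ : ∀ {n} (f : Fin n → Bool) a len →
         (∀ x → f x ≡ true → a ≤ toℕ x × toℕ x < a + len) → count f ≤ len
count≤ {zero}  f a len supp = z≤n
count≤ {suc n} f (suc a) len supp with f zero in f0
... | true  = contradiction (proj₁ (supp zero f0)) λ ()
... | false = count≤ (f ∘ suc) a len λ x fx →
  let p , q = supp (suc x) fx in ≤-pred p , ≤-pred q
count≤ {suc n} f zero zero supp with f zero in f0
... | true  = contradiction (proj₂ (supp zero f0)) λ ()
... | false = count≤ (f ∘ suc) 0 0 λ x fx → contradiction (proj₂ (supp (suc x) fx)) λ ()
count≤ {suc n} f zero (suc len) supp =
  +-mono-≤ (bit≤1 (f zero))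
    (count≤ (f ∘ suc) 0 len λ x fx → z≤n , ≤-pred (proj₂ (supp (suc x) fx)))

≤count : ∀ {n} (f : Fin n → Bool) a len → a + len ≤ n →
         (∀ x → a ≤ toℕ x → toℕ x < a + len → f x ≡ true) → len ≤ count f
≤count {n} f zero zero a+len≤n full = z≤n
≤count {suc n} f (suc a) len (s≤s a+len≤n) full =
  ≤-trans (≤count (f ∘ suc) a len a+len≤n λ x p q → full (suc x) (s≤s p) (s≤s q))
          (m≤n+m _ (bit (f zero)))
≤count {suc n} f zero (suc len) (s≤s len≤n) full rewrite full zero z≤n (s≤s z≤n) =
  s≤s (≤count (f ∘ suc) 0 len len≤n λ x _ q → full (suc x) z≤n (s≤s q))
≤count {zero} f (suc a) len () full

count>0⇒∃ : ∀ {n} (f : Fin n → Bool) → count f > 0 → ∃ λ x → f x ≡ true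
count>0⇒∃ {suc n} f pos with f zero in f0
... | true  = zero , f0
... | false = let x , fx = count>0⇒∃ (f ∘ suc) pos in suc x , fx

suc≡+1 : ∀ {x y} → y ≡ suc x → suc y ≡ suc x + 1
suc≡+1 {x} refl = cong suc (+-comm 1 x)

∣n-1+n∣≡1 : ∀ n → ∣ n - suc n ∣ ≡ 1
∣n-1+n∣≡1 zero    = refl
∣n-1+n∣≡1 (suc n) = ∣n-1+n∣≡1 n

suc⇒≤ : ∀ {x y} → y ≡ suc x → x ≤ y
suc⇒≤ refl = n≤1+n _

≤⊎≥suc : ∀ {x y} → y ≡ suc x → ∀ z → z ≤ x ⊎ y ≤ z
≤⊎≥suc {x} refl z = ≤-<-connex z x

first≤ : ∀ {n} .{{_ : NonZero n}} (j : Fin n) → first Fin.≤ j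
first≤ {suc n} j = z≤n

≤last : ∀ {n} .{{_ : NonZero n}} (j : Fin n) → j Fin.≤ last
≤last {suc n} = Fin.≤fromℕ

pos-first : ∀ {n} .{{_ : NonZero n}} → pos (first {n}) ≡ 1
pos-first {suc n} = refl

pos-last : ∀ {n} .{{_ : NonZero n}} → pos (last {n}) ≡ n
pos-last {suc n} = cong suc (Fin.toℕ-fromℕ n)

data Side : Set where
  low high : Side

-- x lies at least as far towards the given end as y does.
_≼[_]_ : ℕ → Side → ℕ → Set
x ≼[ low  ] y = x ≤ y
x ≼[ high ] y = y ≤ x

opposite : Side → Side
opposite low  = high
opposite high = low

_≺[_]_ : ℕ → Side → ℕ → Set
x ≺[ low  ] y = x < y
x ≺[ high ] y = y < x

≺? : ∀ s x y → Dec (x ≺[ s ] y)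
≺? low  x y = x <? y
≺? high x y = y <? x

≼-refl : ∀ s {x} → x ≼[ s ] x
≼-refl low  = ≤-refl
≼-refl high = ≤-refl

≼-reflexive : ∀ s {x y} → x ≡ y → x ≼[ s ] y
≼-reflexive s refl = ≼-refl s

≼-trans : ∀ s {x y z} → x ≼[ s ] y → y ≼[ s ] z → x ≼[ s ] z
≼-trans low  p q = ≤-trans p q
≼-trans high p q = ≤-trans q p

≼⇒⊁ : ∀ s {x y} → x ≼[ s ] y → Not (y ≺[ s ] x)
≼⇒⊁ low  = ≤⇒≯
≼⇒⊁ high = ≤⇒≯

⋠⇒≻ : ∀ s {x y} → Not (x ≼[ s ] y) → y ≺[ s ] x
⋠⇒≻ low  = ≰⇒>
⋠⇒≻ high = ≰⇒>

≼⇒≺⊎≡ : ∀ s {x y} → x ≼[ s ] y → x ≺[ s ] y ⊎ x ≡ y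
≼⇒≺⊎≡ low  p = m≤n⇒m<n∨m≡n p
≼⇒≺⊎≡ high p with m≤n⇒m<n∨m≡n p
... | inj₁ q = inj₁ q
... | inj₂ e = inj₂ (sym e)

≺-side-unique : ∀ s t {x y} → x ≺[ s ] y → x ≺[ t ] y → s ≡ t
≺-side-unique low  low  p q = refl
≺-side-unique low  high p q = contradiction q (<-asym p)
≺-side-unique high low  p q = contradiction q (<-asym p)
≺-side-unique high high p q = refl

≺-step : ∀ s {x y z} → x ≺[ s ] z → ∣ x - y ∣ ≤ 1 → y ≼[ s ] z
≺-step low {x} {y} x<z d =
  ≤-trans (m≤n+∣n-m∣ y x) (≤-trans (+-monoʳ-≤ x d) (≤-trans (≤-reflexive (+-comm x 1)) x<z))
≺-step high {x} {y} z<x d =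
  ≤-pred (≤-trans z<x (≤-trans (m≤n+∣m-n∣ x y) (≤-trans (+-monoʳ-≤ y d) (≤-reflexive (+-comm y 1)))))

vside hside : Symbol → Side
vside A = low
vside B = low
vside C = high
vside D = high
hside A = low
hside B = high
hside C = low
hside D = high

symbol : Side → Side → Symbol
symbol low  low  = A
symbol low  high = B
symbol high low  = C
symbol high high = D

symbol-sides : ∀ X → symbol (vside X) (hside X) ≡ X
symbol-sides A = refl
symbol-sides B = refl
symbol-sides C = refl
symbol-sides D = refl

⟦_⟧ : ∀ {V} → Formula V → (V → Bool) → Set
⟦ var x ⟧ ν = ν x ≡ true
⟦ ⊤ ⟧     ν = Unit
⟦ ¬ φ ⟧   ν = Not (⟦ φ ⟧ ν)
⟦ φ ∧ ψ ⟧ ν = ⟦ φ ⟧ ν × ⟦ ψ ⟧ ν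
⟦ φ ⇒ ψ ⟧ ν = ⟦ φ ⟧ ν → ⟦ ψ ⟧ ν

module _ {V : Set} {ν : V → Bool} where

  ⟦⟧? : ∀ φ → Dec (⟦ φ ⟧ ν)
  eval-does : ∀ φ → eval ν φ ≡ does (⟦⟧? φ)

  ⟦⟧? (var x) = ν x Bool.≟ true
  ⟦⟧? ⊤       = yes tt
  ⟦⟧? (¬ φ)   = ⟦⟧? φ →-dec no id
  ⟦⟧? (φ ∧ ψ) = ⟦⟧? φ ×-dec ⟦⟧? ψ
  ⟦⟧? (φ ⇒ ψ) = ⟦⟧? φ →-dec ⟦⟧? ψ

  eval-does (var x) with ν x
  ... | true  = refl
  ... | false = refl
  eval-does ⊤ = refl
  eval-does (¬ φ) rewrite eval-does φ with does (⟦⟧? φ)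
  ... | true  = refl
  ... | false = refl
  eval-does (φ ∧ ψ) rewrite eval-does φ | eval-does ψ = refl
  eval-does (φ ⇒ ψ) rewrite eval-does φ | eval-does ψ = refl

  eval⇒⟦⟧ : ∀ φ → eval ν φ ≡ true → ⟦ φ ⟧ ν
  eval⇒⟦⟧ φ e = does⇒ (⟦⟧? φ) (trans (sym (eval-does φ)) e)

  ⟦⟧⇒eval : ∀ φ → ⟦ φ ⟧ ν → eval ν φ ≡ true
  ⟦⟧⇒eval φ p = trans (eval-does φ) (dec-true (⟦⟧? φ) p)

  ⋀-elim : ∀ {I : Set} (is : List I) {φ : I → Formula V} {i} →
           ⟦ ⋀[ is ] φ ⟧ ν → i ∈ˡ is → ⟦ φ i ⟧ ν
  ⋀-elim (_ ∷ _)  (p , _)  (here refl)  = p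
  ⋀-elim (_ ∷ is) (_ , ps) (there i∈is) = ⋀-elim is ps i∈is

  ⋀-intro : ∀ {I : Set} (is : List I) {φ : I → Formula V} →
            (∀ i → i ∈ˡ is → ⟦ φ i ⟧ ν) → ⟦ ⋀[ is ] φ ⟧ ν
  ⋀-intro []       p = tt
  ⋀-intro (i ∷ is) p = p i (here refl) , ⋀-intro is λ j j∈is → p j (there j∈is)

unpos-pos : ∀ {m} (i : Fin m) → unpos m (pos i) ≡ just i
unpos-pos {m} i with toℕ i <? m
... | yes i<m = cong just (Fin.fromℕ<-toℕ i i<m)
... | no  i≮m = contradiction (Fin.toℕ<n i) i≮m

unpos-just : ∀ {m} x {i : Fin m} → unpos m x ≡ just i → pos i ≡ x
unpos-just {m} (suc x) eq with x <? m
unpos-just {m} (suc x) refl | yes x<m = cong suc (Fin.toℕ-fromℕ< x<m)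

module _ {m n : ℕ} {ν : Var {m} {n} → Bool} {X : Symbol} where

  at-elim : ∀ {x y} {i : Fin m} {j : Fin n} → ⟦ X [ x , y ] ⟧ ν →
            pos i ≡ x → pos j ≡ y → ν (X , i , j) ≡ true
  at-elim {i = i} {j} p refl refl rewrite unpos-pos i | unpos-pos j = p

  at-intro : ∀ {x y} → (∀ (i : Fin m) (j : Fin n) → pos i ≡ x → pos j ≡ y → ν (X , i , j) ≡ true) →
             ⟦ X [ x , y ] ⟧ ν
  at-intro {x} {y} p with unpos m x in ex | unpos n y in ey
  ... | just i  | just j  = p i j (unpos-just x ex) (unpos-just y ey)
  ... | just _  | nothing = tt
  ... | nothing | _       = tt

  at-pos : ∀ {x y} {i : Fin m} {j : Fin n} → ν (X , i , j) ≡ true →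
           pos i ≡ x → pos j ≡ y → ⟦ X [ x , y ] ⟧ ν
  at-pos {i = i} {j} p refl refl rewrite unpos-pos i | unpos-pos j = p

  at-refuted : ∀ {x y} → Not (⟦ X [ x , y ] ⟧ ν) →
               ∃₂ λ (i : Fin m) (j : Fin n) → pos i ≡ x × pos j ≡ y × Not (ν (X , i , j) ≡ true)
  at-refuted {x} {y} p with unpos m x in ex | unpos n y in ey
  ... | just i  | just j  = i , j , unpos-just x ex , unpos-just y ey , p
  ... | just _  | nothing = contradiction tt p
  ... | nothing | _       = contradiction tt p

∀cells-elim : ∀ {m n} {φ : Fin m → Fin n → Formula (Var {m} {n})} {ν} →
              ⟦ ∀cells φ ⟧ ν → ∀ i j → ⟦ φ i j ⟧ ν
∀cells-elim p i j = ⋀-elim (allFin _) (⋀-elim (allFin _) p (∈-allFin i)) (∈-allFin j)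

∀cells-intro : ∀ {m n} {φ : Fin m → Fin n → Formula (Var {m} {n})} {ν} →
               (∀ i j → ⟦ φ i j ⟧ ν) → ⟦ ∀cells φ ⟧ ν
∀cells-intro p = ⋀-intro (allFin _) λ i _ → ⋀-intro (allFin _) λ j _ → p i j

⋀-filter-elim : ∀ {V : Set} {ν : V → Bool} {m} {P : Fin m → Set} (P? : ∀ i → Dec (P i))
                {φ : Fin m → Formula V} →
                ⟦ ⋀[ filter P? (allFin m) ] φ ⟧ ν → ∀ i → P i → ⟦ φ i ⟧ ν
⋀-filter-elim P? p i Pi = ⋀-elim (filter P? (allFin _)) p (∈-filter⁺ P? (∈-allFin i) Pi)

⋀-filter-intro : ∀ {V : Set} {ν : V → Bool} {m} {P : Fin m → Set} (P? : ∀ i → Dec (P i))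
                 {φ : Fin m → Formula V} →
                 (∀ i → P i → ⟦ φ i ⟧ ν) → ⟦ ⋀[ filter P? (allFin m) ] φ ⟧ ν
⋀-filter-intro P? p = ⋀-intro (filter P? (allFin _)) λ i i∈ → p i (proj₂ (∈-filter⁻ P? {xs = allFin _} i∈))

module _ {m n : ℕ} {T : Object m n} where

  Path : Vertex T → Vertex T → Set
  Path = Star (Adjacent on proj₁)

  Path-sym : ∀ {u v} → Path u v → Path v u
  Path-sym = reverse λ {u} {v} → Adjacent-sym {proj₁ u} {proj₁ v}
    where
    Adjacent-sym : ∀ {u v : Cell m n} → Adjacent u v → Adjacent v u
    Adjacent-sym {i , j} {i′ , j′} =
      subst₂ (λ x y → x + y ≤ 1) (∣-∣-comm (toℕ i) (toℕ i′)) (∣-∣-comm (toℕ j) (toℕ j′))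

  vertical : ∀ {i i′ : Fin m} {j : Fin n} → toℕ i′ ≡ suc (toℕ i) → Adjacent (i , j) (i′ , j)
  vertical {i} {j = j} e rewrite e | ∣n-1+n∣≡1 (toℕ i) | ∣n-n∣≡0 (toℕ j) = ≤-refl

  horizontal : ∀ {i : Fin m} {j j′ : Fin n} → toℕ j′ ≡ suc (toℕ j) → Adjacent (i , j) (i , j′)
  horizontal {i} {j = j} e rewrite e | ∣n-1+n∣≡1 (toℕ j) | ∣n-n∣≡0 (toℕ i) = ≤-refl

  column-path : VConvex T → ∀ {i i′ j} (t : T i j ≡ true) (t′ : T i′ j ≡ true) →
                i Fin.≤ i′ → Path ((i , j) , t) ((i′ , j) , t′)
  column-path vc {i} {i′} {j} t t′ i≤i′
    with walk (λ z → z Fin.≤ i′ → ∃ λ s → Path ((i , j) , t) ((z , j) , s))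
              (λ {x} {y} e f y≤i′ →
                let s , p = f (≤-trans (suc⇒≤ e) y≤i′)
                in vc j x y i′ s t′ (suc⇒≤ e) y≤i′
                 , p ◅◅ vertical {x} {y} {j} e ◅ ε)
              i≤i′ (λ _ → t , ε) ≤-refl
  ... | s , p rewrite UIP.≡-irrelevant Bool._≟_ s t′ = p

  column-connected : VConvex T → ∀ {i i′ j} (t : T i j ≡ true) (t′ : T i′ j ≡ true) →
                     Path ((i , j) , t) ((i′ , j) , t′)
  column-connected vc {i} {i′} t t′ with ≤-total (toℕ i) (toℕ i′)
  ... | inj₁ i≤i′ = column-path vc t t′ i≤i′
  ... | inj₂ i′≤i = Path-sym (column-path vc t′ t i′≤i)

  overlaps⇒polyomino : .{{_ : NonZero n}} → VConvex T →
    (∀ {j j′} → toℕ j′ ≡ suc (toℕ j) → ∃ λ i → T i j ≡ true × T i j′ ≡ true) →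
    (∃ λ i → T i first ≡ true) → IsPolyomino T
  overlaps⇒polyomino vc meet (k , root) u v = to-root u ◅◅ Path-sym (to-root v)
    where
    to-root : ∀ u → Path u ((k , first) , root)
    to-root ((i , j) , t) =
      walk (λ z → ∀ i (t : T i z ≡ true) → Path ((i , z) , t) ((k , first) , root))
           (λ {x} {y} e f i t →
             let a , s , s′ = meet e in
             column-connected vc t s′ ◅◅
             Path-sym (horizontal {a} {x} {y} e ◅ ε) ◅◅ f a s)
           (first≤ j) (λ i t → column-connected vc t root) i t

Adjacent⇒aligned : ∀ {m n} {i i′ : Fin m} {j j′ : Fin n} → Adjacent (i , j) (i′ , j′) → i ≡ i′ ⊎ j ≡ j′
Adjacent⇒aligned {i = i} {i′} {j} {j′} adj with ∣ toℕ i - toℕ i′ ∣ in e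
... | zero  = inj₁ (Fin.toℕ-injective (∣m-n∣≡0⇒m≡n e))
... | suc _ = inj₂ (Fin.toℕ-injective (∣m-n∣≡0⇒m≡n (n≤0⇒n≡0 (m+n≤o⇒n≤o _ (≤-pred adj)))))

module FromValuation {m n : ℕ} (ν : Var {m} {n} → Bool) where

  Marked : Symbol → Fin m → Fin n → Set
  Marked X i j = ν (X , i , j) ≡ true

  free? : ∀ i j → Dec (∀ X → Not (Marked X i j))
  free? i j = Fin.all? λ X → (ν (X , i , j) Bool.≟ true) →-dec no id

  T : Object m n
  T i j = does (free? i j)

  free : ∀ {i j} → T i j ≡ true → ∀ X → Not (Marked X i j)
  free {i} {j} = does⇒ (free? i j)

  classify : ∀ i j → T i j ≡ true ⊎ ∃ λ X → Marked X i j
  classify i j with Fin.any? (λ X → ν (X , i , j) Bool.≟ true)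
  ... | yes p = inj₂ p
  ... | no ¬p = inj₁ (dec-true (free? i j) λ X h → ¬p (X , h))

  module _ (cor : ⟦ Cor ⟧ ν) where

    v-mono : ∀ X {i i′ j} → toℕ i′ ≼[ vside X ] toℕ i → Marked X i j → Marked X i′ j
    v-mono A {j = j} le = walk⁻ (λ i → Marked A i j)
      (λ {x} {y} e h → let s , _ = ∀cells-elim cor y j in
        at-elim (s (at-pos h refl refl)) (sym e) refl) le
    v-mono B {j = j} le = walk⁻ (λ i → Marked B i j)
      (λ {x} {y} e h → let _ , _ , s , _ = ∀cells-elim cor y j in
        at-elim (s (at-pos h refl refl)) (sym e) refl) le
    v-mono C {j = j} le = walk (λ i → Marked C i j)
      (λ {x} {y} e h → let _ , _ , _ , _ , s , _ = ∀cells-elim cor x j in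
        at-elim (s (at-pos h refl refl)) (suc≡+1 e) refl) le
    v-mono D {j = j} le = walk (λ i → Marked D i j)
      (λ {x} {y} e h → let _ , _ , _ , _ , _ , _ , s , _ = ∀cells-elim cor x j in
        at-elim (s (at-pos h refl refl)) (suc≡+1 e) refl) le

    h-mono : ∀ X {i j j′} → toℕ j′ ≼[ hside X ] toℕ j → Marked X i j → Marked X i j′
    h-mono A {i} le = walk⁻ (Marked A i)
      (λ {x} {y} e h → let _ , s , _ = ∀cells-elim cor i y in
        at-elim (s (at-pos h refl refl)) refl (sym e)) le
    h-mono B {i} le = walk (Marked B i)
      (λ {x} {y} e h → let _ , _ , _ , s , _ = ∀cells-elim cor i x in
        at-elim (s (at-pos h refl refl)) refl (suc≡+1 e)) le
    h-mono C {i} le = walk⁻ (Marked C i)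
      (λ {x} {y} e h → let _ , _ , _ , _ , _ , s , _ = ∀cells-elim cor i y in
        at-elim (s (at-pos h refl refl)) refl (sym e)) le
    h-mono D {i} le = walk (Marked D i)
      (λ {x} {y} e h → let _ , _ , _ , _ , _ , _ , _ , s = ∀cells-elim cor i x in
        at-elim (s (at-pos h refl refl)) refl (suc≡+1 e)) le

    v-convex : VConvex T
    v-convex j p i q tp tq p≤i i≤q with classify i j
    ... | inj₁ t       = t
    ... | inj₂ (X , h) with vside X in side
    ... | low  = contradiction (v-mono X (subst (λ s → _ ≼[ s ] _) (sym side) p≤i) h) (free tp X)
    ... | high = contradiction (v-mono X (subst (λ s → _ ≼[ s ] _) (sym side) i≤q) h) (free tq X)

    h-convex : HConvex T
    h-convex i p j q tp tq p≤j j≤q with classify i j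
    ... | inj₁ t       = t
    ... | inj₂ (X , h) with hside X in side
    ... | low  = contradiction (h-mono X (subst (λ s → _ ≼[ s ] _) (sym side) p≤j) h) (free tp X)
    ... | high = contradiction (h-mono X (subst (λ s → _ ≼[ s ] _) (sym side) j≤q) h) (free tq X)

    module _ (con : ⟦ Con ⟧ ν) where

      con-AD : ∀ {i i′ j j′} → toℕ i′ ≡ suc (toℕ i) → toℕ j′ ≡ suc (toℕ j) →
               Marked A i j → Not (Marked D i′ j′)
      con-AD {i} {j = j} ei ej a d = proj₁ (∀cells-elim con i j)
        (at-pos a refl refl) (at-pos d (suc≡+1 ei) (suc≡+1 ej))

      con-BC : ∀ {i i′ j j′} → toℕ i′ ≡ suc (toℕ i) → toℕ j′ ≡ suc (toℕ j) →
               Marked B i j′ → Not (Marked C i′ j)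
      con-BC {i} {j′ = j′} ei ej b c = proj₂ (∀cells-elim con i j′)
        (at-pos b refl refl) (at-pos c (suc≡+1 ei) (sym ej))

      Overlap : Fin n → Fin n → Set
      Overlap j j′ = ∃ λ i → T i j ≡ true × T i j′ ≡ true

      overlap-down : ∀ {j j′ p q} → toℕ j′ ≡ suc (toℕ j) → T p j ≡ true → T q j′ ≡ true →
                     p Fin.≤ q → Overlap j j′
      overlap-down {j} {j′} {p} {q} ej tp tq p≤q =
        case walk (λ x → x Fin.≤ q → Overlap j j′ ⊎ T x j ≡ true) step p≤q (λ _ → inj₂ tp) ≤-refl
        of λ where
          (inj₁ o)  → o
          (inj₂ tq′) → q , tq′ , tq
        where
        j≤j′ = suc⇒≤ ej
        step : ∀ {x y} → toℕ y ≡ suc (toℕ x) → (x Fin.≤ q → Overlap j j′ ⊎ T x j ≡ true) →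
               y Fin.≤ q → Overlap j j′ ⊎ T y j ≡ true
        step {x} {y} e f y≤q with x≤y ← suc⇒≤ e with f (≤-trans x≤y y≤q)
        ... | inj₁ o = inj₁ o
        ... | inj₂ tx with classify x j′
        ... | inj₁ tx′ = inj₁ (x , tx , tx′)
        ... | inj₂ (A , h) = contradiction (h-mono A j≤j′ h) (free tx A)
        ... | inj₂ (C , h) = contradiction (v-mono C (≤-trans x≤y y≤q) h) (free tq C)
        ... | inj₂ (D , h) = contradiction (v-mono D (≤-trans x≤y y≤q) h) (free tq D)
        ... | inj₂ (B , b) with classify y j
        ... | inj₁ ty = inj₂ ty
        ... | inj₂ (A , h) = contradiction (v-mono A x≤y h) (free tx A)
        ... | inj₂ (B , h) = contradiction (v-mono B x≤y h) (free tx B)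
        ... | inj₂ (C , h) = contradiction h (con-BC e ej b)
        ... | inj₂ (D , h) = contradiction (v-mono D y≤q (h-mono D j≤j′ h)) (free tq D)

      overlap-up : ∀ {j j′ p q} → toℕ j′ ≡ suc (toℕ j) → T p j ≡ true → T q j′ ≡ true →
                   q Fin.≤ p → Overlap j j′
      overlap-up {j} {j′} {p} {q} ej tp tq q≤p =
        case walk (λ x → x Fin.≤ p → Overlap j j′ ⊎ T x j′ ≡ true) step q≤p (λ _ → inj₂ tq) ≤-refl
        of λ where
          (inj₁ o)  → o
          (inj₂ tp′) → p , tp , tp′
        where
        j≤j′ = suc⇒≤ ej
        step : ∀ {x y} → toℕ y ≡ suc (toℕ x) → (x Fin.≤ p → Overlap j j′ ⊎ T x j′ ≡ true) →
               y Fin.≤ p → Overlap j j′ ⊎ T y j′ ≡ true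
        step {x} {y} e f y≤p with x≤y ← suc⇒≤ e with f (≤-trans x≤y y≤p)
        ... | inj₁ o = inj₁ o
        ... | inj₂ tx with classify x j
        ... | inj₁ tx′ = inj₁ (x , tx′ , tx)
        ... | inj₂ (B , h) = contradiction (h-mono B j≤j′ h) (free tx B)
        ... | inj₂ (C , h) = contradiction (v-mono C (≤-trans x≤y y≤p) h) (free tp C)
        ... | inj₂ (D , h) = contradiction (v-mono D (≤-trans x≤y y≤p) h) (free tp D)
        ... | inj₂ (A , a) with classify y j′
        ... | inj₁ ty = inj₂ ty
        ... | inj₂ (A , h) = contradiction (v-mono A x≤y h) (free tx A)
        ... | inj₂ (B , h) = contradiction (v-mono B x≤y h) (free tx B)
        ... | inj₂ (C , h) = contradiction (v-mono C y≤p (h-mono C j≤j′ h)) (free tp C)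
        ... | inj₂ (D , h) = contradiction h (con-AD e ej a)

      meet : ∀ {j j′} → toℕ j′ ≡ suc (toℕ j) → (∀ j → ∃ λ i → T i j ≡ true) → Overlap j j′
      meet {j} {j′} ej nonempty with nonempty j | nonempty j′
      ... | p , tp | q , tq with ≤-total (toℕ p) (toℕ q)
      ... | inj₁ p≤q = overlap-down ej tp tq p≤q
      ... | inj₂ q≤p = overlap-up ej tp tq q≤p

    -- a counts the cells at the top of column j marked A or B; LBC frees the next c j cells.
    column≥ : ∀ {c} → ⟦ LBC c ⟧ ν → ∀ j → c j ≤ count (λ i → T i j)
    column≥ {c} lbc j with threshold {P = Top} top? closed
      where
      Top : Fin m → Set
      Top i = Marked A i j ⊎ Marked B i j
      top? : ∀ i → Dec (Top i)
      top? i = (ν (A , i , j) Bool.≟ true) ⊎-dec (ν (B , i , j) Bool.≟ true)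
      closed : ∀ {i i′} → i Fin.≤ i′ → Top i′ → Top i
      closed le (inj₁ h) = inj₁ (v-mono A le h)
      closed le (inj₂ h) = inj₂ (v-mono B le h)
    ... | a , a≤m , below , above with bottom a a≤m below
      where
      bottom : ∀ a → a ≤ m → (∀ i → toℕ i < a → Marked A i j ⊎ Marked B i j) →
               Not (⟦ C [ a + c j , pos j ] ⟧ ν) × Not (⟦ D [ a + c j , pos j ] ⟧ ν)
      bottom zero    _   _     = ⋀-elim (allFin n) (proj₂ lbc) (∈-allFin j)
      bottom (suc a) a<m below with index a<m
      ... | i , refl with ∀cells-elim (proj₁ lbc) i j | below i ≤-refl
      ... | ac , ad , bc , bd | inj₁ h = ac (at-pos h refl refl) , ad (at-pos h refl refl)
      ... | ac , ad , bc , bd | inj₂ h = bc (at-pos h refl refl) , bd (at-pos h refl refl)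
    ... | ¬C , ¬D with at-refuted ¬C | at-refuted ¬D
    ... | i , j₁ , ei , ej , ¬c | i′ , j₂ , ei′ , ej′ , ¬d
      with Fin.toℕ-injective (suc-injective ej) | Fin.toℕ-injective (suc-injective ej′)
    ... | refl | refl =
      ≤count (λ i → T i j) a (c j) (subst (_≤ m) ei (Fin.toℕ<n i)) λ x a≤x x<a+c →
      case classify x j of λ where
        (inj₁ t) → t
        (inj₂ (A , h)) → contradiction (above x (inj₁ h)) (≤⇒≯ a≤x)
        (inj₂ (B , h)) → contradiction (above x (inj₂ h)) (≤⇒≯ a≤x)
        (inj₂ (C , h)) → contradiction (v-mono C (≤-pred (subst (suc (toℕ x) ≤_) (sym ei) x<a+c)) h) ¬c
        (inj₂ (D , h)) → contradiction (v-mono D (≤-pred (subst (suc (toℕ x) ≤_) (sym ei′) x<a+c)) h) ¬d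

    row≤-between : ∀ L R → hside L ≡ low → hside R ≡ high → ∀ i r →
            (∀ j → Not (⟦ L [ pos i , pos j ] ⟧ ν) → ⟦ R [ pos i , pos j + r ] ⟧ ν) →
            count (T i) ≤ r
    row≤-between L R eL eR i r ubr with threshold {P = Marked L i} (λ j → ν (L , i , j) Bool.≟ true)
                             (λ le → h-mono L (subst (λ s → _ ≼[ s ] _) (sym eL) le))
    ... | a , _ , below , above = count≤ (T i) a r λ x t → a≤ x t , <a+r x t
      where
      a≤ : ∀ x → T i x ≡ true → a ≤ toℕ x
      a≤ x t = ≮⇒≥ λ x<a → free t L (below x x<a)
      <a+r : ∀ x → T i x ≡ true → toℕ x < a + r
      <a+r x t = ≰⇒> λ a+r≤x → case index (≤-<-trans (a≤ x t) (Fin.toℕ<n x)) of λ where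
        (z , refl) → case index (≤-<-trans a+r≤x (Fin.toℕ<n x)) of λ where
          (y , y≡a+r) →
            free t R (h-mono R (subst (λ s → toℕ x ≼[ s ] toℕ y) (sym eR)
                                 (subst (_≤ toℕ x) (sym y≡a+r) a+r≤x))
              (at-elim (ubr z λ h → <-irrefl refl (above z (at-elim h refl refl))) refl (cong suc y≡a+r)))

    row≤ : ∀ {k l r} → ⟦ UBR k l r ⟧ ν → ∀ i → count (T i) ≤ r i
    row≤ {k} {l} {r} ubr i with ≤-total (pos i) (pos k) | ≤-total (pos i) (pos l)
    ... | inj₁ i≤k | inj₁ i≤l = row≤-between A B refl refl i (r i) λ j →
      let u , _ = ⋀-elim (allFin n) ubr (∈-allFin j) in ⋀-filter-elim _ u i (⊓-glb i≤k i≤l)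
    ... | inj₂ k≤i | inj₁ i≤l = row≤-between C B refl refl i (r i) λ j →
      let _ , u , _ = ⋀-elim (allFin n) ubr (∈-allFin j) in ⋀-filter-elim _ u i (k≤i , i≤l)
    ... | inj₁ i≤k | inj₂ l≤i = row≤-between A D refl refl i (r i) λ j →
      let _ , _ , u , _ = ⋀-elim (allFin n) ubr (∈-allFin j) in ⋀-filter-elim _ u i (l≤i , i≤k)
    ... | inj₂ k≤i | inj₂ l≤i = row≤-between C D refl refl i (r i) λ j →
      let _ , _ , _ , u = ⋀-elim (allFin n) ubr (∈-allFin j) in ⋀-filter-elim _ u i (⊔-lub k≤i l≤i)

  anchored : .{{_ : NonZero n}} → ∀ {k l} → ⟦ Anc k l ⟧ ν → Anchored k l T
  anchored {k} {l} (a , b , c , d , a′ , b′ , c′ , d′) =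
      dec-true (free? k first) (λ where
        A h → a (at-pos h refl pos-first)
        B h → b (at-pos h refl pos-first)
        C h → c (at-pos h refl pos-first)
        D h → d (at-pos h refl pos-first))
    , dec-true (free? l last) (λ where
        A h → a′ (at-pos h refl pos-last)
        B h → b′ (at-pos h refl pos-last)
        C h → c′ (at-pos h refl pos-last)
        D h → d′ (at-pos h refl pos-last))

module FromObject {m n : ℕ} (T : Object m n)
  (row-nonempty : ∀ i → ∃ λ j → T i j ≡ true)
  (column-nonempty : ∀ j → ∃ λ i → T i j ≡ true)
  (polyomino : IsPolyomino T)
  where

  Beside Past : Side → Fin m → Fin n → Set
  Beside s i j = ∀ q → T i q ≡ true → toℕ j ≺[ s ] toℕ q
  Past   s i j = ∀ p → T p j ≡ true → toℕ i ≺[ s ] toℕ p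

  Corner : Side → Side → Fin m → Fin n → Set
  Corner v h i j = Past v i j × Beside h i j

  corner? : ∀ v h i j → Dec (Corner v h i j)
  corner? v h i j =
    Fin.all? (λ p → (T p j Bool.≟ true) →-dec ≺? v (toℕ i) (toℕ p)) ×-dec
    Fin.all? (λ q → (T i q Bool.≟ true) →-dec ≺? h (toℕ j) (toℕ q))

  closed-region : (S : Fin m → Fin n → Set) →
    (∀ {i i′ j j′} → T i j ≡ true → T i′ j′ ≡ true → Adjacent (i , j) (i′ , j′) → S i j → S i′ j′) →
    ∀ {i i′ j j′} → T i j ≡ true → T i′ j′ ≡ true → S i j → S i′ j′
  closed-region S closed t t′ = follow (polyomino (_ , t) (_ , t′))
    where
    follow : ∀ {u v} → Path {T = T} u v → let (i , j) , _ = u; (i′ , j′) , _ = v in S i j → S i′ j′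
    follow ε s = s
    follow (_◅_ {i = _ , tu} {j = _ , tw} adj p) s = follow p (closed tu tw adj s)

  corner-empty : ∀ {v h i j x y} → Corner v h i j → T x y ≡ true →
                 toℕ x ≼[ v ] toℕ i → Not (toℕ y ≼[ h ] toℕ j)
  corner-empty {v} {h} {i} {j} (past , beside) t x≼i y≼j =
    let q , tq = row-nonempty i in
    ≼⇒⊁ h (proj₂ (closed-region Outer closed t tq (x≼i , y≼j))) (beside q tq)
    where
    Outer : Fin m → Fin n → Set
    Outer x y = toℕ x ≼[ v ] toℕ i × toℕ y ≼[ h ] toℕ j
    closed : ∀ {x x′ y y′} → T x y ≡ true → T x′ y′ ≡ true → Adjacent (x , y) (x′ , y′) →
             Outer x y → Outer x′ y′
    closed {x} {x′} {y} {y′} t _ adj (x≼i , y≼j) with ≼⇒≺⊎≡ v x≼i | ≼⇒≺⊎≡ h y≼j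
    ... | inj₁ x≺i | inj₁ y≺j =
      ≺-step v x≺i (m+n≤o⇒m≤o _ adj) , ≺-step h y≺j (m+n≤o⇒n≤o ∣ toℕ x - toℕ x′ ∣ adj)
    ... | inj₂ x≡i | _ with refl ← Fin.toℕ-injective x≡i = contradiction (beside y t) (≼⇒⊁ h y≼j)
    ... | inj₁ _ | inj₂ y≡j with refl ← Fin.toℕ-injective y≡j = contradiction (past x t) (≼⇒⊁ v x≼i)

  corner-mono : ∀ {v h i i′ j j′} → toℕ i′ ≼[ v ] toℕ i → toℕ j′ ≼[ h ] toℕ j →
                Corner v h i j → Corner v h i′ j′
  corner-mono {v} {h} i′≼i j′≼j c =
      (λ p t → ⋠⇒≻ v λ p≼i′ → corner-empty c t (≼-trans v p≼i′ i′≼i) j′≼j)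
    , (λ q t → ⋠⇒≻ h λ q≼j′ → corner-empty c t i′≼i (≼-trans h q≼j′ j′≼j))

  corner-free : ∀ {v h i j} → Corner v h i j → Not (T i j ≡ true)
  corner-free {v} {h} c t = corner-empty c t (≼-refl v) (≼-refl h)

  corner-unique : ∀ {v v′ h h′ i j} → Corner v h i j → Corner v′ h′ i j → symbol v h ≡ symbol v′ h′
  corner-unique {v} {v′} {h} {h′} {i} {j} (past , beside) (past′ , beside′)
    with column-nonempty j | row-nonempty i
  ... | p , tp | q , tq
    with refl ← ≺-side-unique v v′ (past p tp) (past′ p tp)
       | refl ← ≺-side-unique h h′ (beside q tq) (beside′ q tq) = refl

  -- The outer quadrants of the two corners cover everything except two blocks that touch at most
  -- diagonally, so T, having no cell in either quadrant, cannot have cells in both blocks.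
  corners-apart : ∀ {v v′ h h′ i i′ j j′} →
    (∀ x → x ≼[ v ] toℕ i ⊎ x ≼[ v′ ] toℕ i′) → (∀ y → y ≼[ h ] toℕ j ⊎ y ≼[ h′ ] toℕ j′) →
    Corner v h i j → Not (Corner v′ h′ i′ j′)
  corners-apart {v} {v′} {h} {h′} {i} {i′} {j} {j′} V H c c′
    with column-nonempty j | row-nonempty i
  ... | p , tp | q , tq with V (toℕ p)
  ... | inj₁ p≼i  = ≼⇒⊁ v p≼i (proj₁ c p tp)
  ... | inj₂ p≼i′ =
    ≼⇒⊁ h (proj₂ (closed-region Between closed tp tq (p≼i′ , ≼-refl h))) (proj₂ c q tq)
    where
    Between : Fin m → Fin n → Set
    Between x y = toℕ x ≼[ v′ ] toℕ i′ × toℕ y ≼[ h ] toℕ j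
    closed : ∀ {x x′ y y′} → T x y ≡ true → T x′ y′ ≡ true → Adjacent (x , y) (x′ , y′) →
             Between x y → Between x′ y′
    closed {x} {x′} {y} {y′} _ t′ adj (x≼i′ , y≼j) with V (toℕ x′) | H (toℕ y′)
    ... | inj₂ p | inj₁ q = p , q
    ... | inj₁ p | inj₁ q = contradiction q (corner-empty c t′ p)
    ... | inj₂ p | inj₂ q = contradiction q (corner-empty c′ t′ p)
    ... | inj₁ p | inj₂ q with Adjacent⇒aligned {i = x} {x′} {y} {y′} adj
    ... | inj₁ refl = contradiction q (corner-empty c′ t′ x≼i′)
    ... | inj₂ refl = contradiction y≼j (corner-empty c t′ p)

  valuation : Var {m} {n} → Bool
  valuation (X , i , j) = does (corner? (vside X) (hside X) i j)

  mark : ∀ X {i j} → Corner (vside X) (hside X) i j → valuation (X , i , j) ≡ true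
  mark X {i} {j} = dec-true (corner? (vside X) (hside X) i j)

  corner : ∀ X {i j} → ⟦ X [ pos i , pos j ] ⟧ valuation → Corner (vside X) (hside X) i j
  corner X {i} {j} h = does⇒ (corner? (vside X) (hside X) i j) (at-elim h refl refl)

  corner-at : ∀ X {i j x y} → ⟦ X [ x , y ] ⟧ valuation → pos i ≡ x → pos j ≡ y →
              Corner (vside X) (hside X) i j
  corner-at X h refl refl = corner X h

  Cor-holds : ⟦ Cor ⟧ valuation
  Cor-holds = ∀cells-intro λ i j →
      move A (suc⇒≤ ∘ sym) (stay low)
    , move A (stay low) (suc⇒≤ ∘ sym)
    , move B (suc⇒≤ ∘ sym) (stay high)
    , move B (stay low) +1⇒≤
    , move C +1⇒≤ (stay low)
    , move C (stay high) (suc⇒≤ ∘ sym)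
    , move D +1⇒≤ (stay high)
    , move D (stay high) +1⇒≤
    where
    stay : ∀ s {x y} → suc x ≡ suc y → x ≼[ s ] y
    stay s e = ≼-reflexive s (suc-injective e)
    +1⇒≤ : ∀ {x y} → suc x ≡ suc y + 1 → y ≤ x
    +1⇒≤ {y = y} e = suc⇒≤ (trans (suc-injective e) (+-comm y 1))
    move : ∀ X {i j x y} →
           (∀ {i′ : Fin m} → pos i′ ≡ x → toℕ i′ ≼[ vside X ] toℕ i) →
           (∀ {j′ : Fin n} → pos j′ ≡ y → toℕ j′ ≼[ hside X ] toℕ j) →
           ⟦ X [ pos i , pos j ] ⇒ X [ x , y ] ⟧ valuation
    move X v h c = at-intro λ i′ j′ ei ej → mark X (corner-mono (v {i′} ei) (h {j′} ej) (corner X c))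

  Dis-holds : ⟦ Dis ⟧ valuation
  Dis-holds = ∀cells-intro λ i j → let dis = λ X Y → disjoint X Y {i} {j} in
      (dis A B (λ ()) , dis A C (λ ()) , dis A D (λ ()) , tt)
    , (dis B A (λ ()) , dis B C (λ ()) , dis B D (λ ()) , tt)
    , (dis C A (λ ()) , dis C B (λ ()) , dis C D (λ ()) , tt)
    , (dis D A (λ ()) , dis D B (λ ()) , dis D C (λ ()) , tt)
    , tt
    where
    disjoint : ∀ X Y {i j} → X ≢ Y → ⟦ X [ pos i , pos j ] ⇒ ¬ Y [ pos i , pos j ] ⟧ valuation
    disjoint X Y X≢Y x y =
      X≢Y (trans (sym (symbol-sides X))
        (trans (corner-unique (corner X x) (corner Y y)) (symbol-sides Y)))

  Con-holds : ⟦ Con ⟧ valuation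
  Con-holds = ∀cells-intro λ i j → con-AD , con-BC
    where
    con-AD : ∀ {i j} → ⟦ A [ pos i , pos j ] ⇒ ¬ D [ pos i + 1 , pos j + 1 ] ⟧ valuation
    con-AD {i} {j} a d with corner A a
    ... | past , beside
      with next (past _ (proj₂ (column-nonempty j))) | next (beside _ (proj₂ (row-nonempty i)))
    ... | i′ , ei | j′ , ej =
      corners-apart {low} {high} {low} {high} (≤⊎≥suc ei) (≤⊎≥suc ej)
        (corner A a) (corner-at D d (suc≡+1 ei) (suc≡+1 ej))
    con-BC : ∀ {i j} → ⟦ B [ pos i , pos j ] ⇒ ¬ C [ pos i + 1 , pos j ∸ 1 ] ⟧ valuation
    con-BC {i} {j} b c with corner B b
    ... | past , beside
      with next (past _ (proj₂ (column-nonempty j))) | previous (beside _ (proj₂ (row-nonempty i)))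
    ... | i′ , ei | j′ , ej =
      corners-apart {low} {high} {high} {low} (≤⊎≥suc ei) (swap ∘ ≤⊎≥suc ej)
        (corner B b) (corner-at C c (suc≡+1 ei) (sym ej))

  Anc-holds : .{{_ : NonZero n}} → ∀ {k l} → Anchored k l T → ⟦ Anc k l ⟧ valuation
  Anc-holds {k} {l} (tk , tl) = at-k A , at-k B , at-k C , at-k D , at-l A , at-l B , at-l C , at-l D
    where
    at-k : ∀ X → Not (⟦ X [ pos k , 1 ] ⟧ valuation)
    at-k X h = corner-free (corner-at X h refl pos-first) tk
    at-l : ∀ X → Not (⟦ X [ pos l , n ] ⟧ valuation)
    at-l X h = corner-free (corner-at X h refl pos-last) tl

  LBC-holds : ∀ {c : Vector ℕ n} → (∀ j → c j > 0) → (∀ j → count (λ i → T i j) ≡ c j) →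
              ⟦ LBC c ⟧ valuation
  LBC-holds {c} c>0 column =
      ∀cells-intro (λ i j →
          (λ h → bound C refl (proj₁ (corner A h)))
        , (λ h → bound D refl (proj₁ (corner A h)))
        , (λ h → bound C refl (proj₁ (corner B h)))
        , (λ h → bound D refl (proj₁ (corner B h))))
    , ⋀-intro (allFin n) λ j _ → bound C refl (λ _ _ → z≤n) , bound D refl (λ _ _ → z≤n)
    where
    bound : ∀ Y → vside Y ≡ high → ∀ {a j} → (∀ x → T x j ≡ true → a ≤ toℕ x) →
            Not (⟦ Y [ a + c j , pos j ] ⟧ valuation)
    bound Y eY {a} {j} a≤ y with c j | c>0 j | column j
    ... | suc d | _ | col =
      <-irrefl refl (subst (_≤ d) col (count≤ (λ i → T i j) a d λ x t →
        a≤ x t , ≰⇒> λ a+d≤x → case index (≤-<-trans a+d≤x (Fin.toℕ<n x)) of λ where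
          (i , i≡a+d) →
            let past , _ = corner-at Y y (trans (cong suc i≡a+d) (sym (+-suc a d))) refl in
            <⇒≱ (subst (λ s → toℕ i ≺[ s ] toℕ x) eY (past x t)) (subst (_≤ toℕ x) (sym i≡a+d) a+d≤x)))

  module _ (h-convex : HConvex T) (v-convex : VConvex T) where

    past-either : ∀ v i j → T i j ≡ true ⊎ Past v i j ⊎ Past (opposite v) i j
    past-either high i j with past-either low i j
    ... | inj₁ t = inj₁ t
    ... | inj₂ (inj₁ p) = inj₂ (inj₂ p)
    ... | inj₂ (inj₂ p) = inj₂ (inj₁ p)
    past-either low i j with T i j in eq
    ... | true = inj₁ refl
    ... | false with Fin.any? (λ p → (T p j Bool.≟ true) ×-dec (toℕ p ≤? toℕ i))
    ... | no none = inj₂ (inj₁ λ p tp → ≰⇒> λ p≤i → none (p , tp , p≤i))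
    ... | yes (p , tp , p≤i) = inj₂ (inj₂ λ q tq → ≰⇒> λ i≤q →
      case trans (sym eq) (v-convex j p i q tp tq p≤i i≤q) of λ ())

    UBR-holds : .{{_ : NonZero n}} → ∀ {k l} {r : Vector ℕ m} → Anchored k l T →
                (∀ i → count (T i) ≡ r i) → ⟦ UBR k l r ⟧ valuation
    UBR-holds {k} {l} {r} (tk , tl) row = ⋀-intro (allFin n) λ j _ →
        ⋀-filter-intro (λ i → pos i ≤? pos k ⊓ pos l) (λ i i≤k⊓l →
          clause A B {i} {j} refl refl
            (≤-pred (m≤n⊓o⇒m≤n (pos k) (pos l) i≤k⊓l))
            (≤-pred (m≤n⊓o⇒m≤o (pos k) (pos l) i≤k⊓l)))
      , ⋀-filter-intro (λ i → pos k ≤? pos i ×-dec pos i ≤? pos l) (λ i (k≤i , i≤l) →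
          clause C B {i} {j} refl refl (≤-pred k≤i) (≤-pred i≤l))
      , ⋀-filter-intro (λ i → pos l ≤? pos i ×-dec pos i ≤? pos k) (λ i (l≤i , i≤k) →
          clause A D {i} {j} refl refl (≤-pred i≤k) (≤-pred l≤i))
      , ⋀-filter-intro (λ i → pos k ⊔ pos l ≤? pos i) (λ i k⊔l≤i →
          clause C D {i} {j} refl refl
            (≤-pred (m⊔n≤o⇒m≤o (pos k) (pos l) k⊔l≤i))
            (≤-pred (m⊔n≤o⇒n≤o (pos k) (pos l) k⊔l≤i)))
      where
      reach : ∀ {v w i j j′} → toℕ k ≼[ opposite v ] toℕ i → toℕ l ≼[ opposite w ] toℕ i →
              toℕ j′ ≡ toℕ j + r i → Not (Corner v low i j) → Corner w high i j′
      reach {v} {w} {i} {j} {j′} k≼i l≼i ej ¬c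
        with Fin.any? (λ q → (T i q Bool.≟ true) ×-dec (toℕ q ≤? toℕ j))
      ... | no none with past-either v i j
      ...   | inj₁ t = contradiction (j , t , ≤-refl) none
      ...   | inj₂ (inj₁ p) = contradiction (p , λ q tq → ≰⇒> λ q≤j → none (q , tq , q≤j)) ¬c
      ...   | inj₂ (inj₂ p) = contradiction (first≤ j)
        (corner-empty {h = low} (p , λ q tq → ≰⇒> λ q≤j → none (q , tq , q≤j)) tk k≼i)
      reach {v} {w} {i} {j} {j′} k≼i l≼i ej ¬c | yes (q , tq , q≤j) = finish (past-either w i j′)
        where
        beside : Beside high i j′
        beside x tx = ≰⇒> λ j′≤x →
          let q+r≤x = ≤-trans (+-monoˡ-≤ (r i) q≤j) (≤-trans (≤-reflexive (sym ej)) j′≤x)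
              q+1+r≡ = +-suc (toℕ q) (r i)
          in <-irrefl refl (subst (suc (r i) ≤_) (row i)
               (≤count (T i) (toℕ q) (suc (r i))
                 (≤-trans (≤-reflexive q+1+r≡) (≤-<-trans q+r≤x (Fin.toℕ<n x)))
                 λ y q≤y y<q+1+r → h-convex i q y x tq tx q≤y
                   (≤-trans (≤-pred (subst (toℕ y <_) q+1+r≡ y<q+1+r)) q+r≤x)))
        finish : T i j′ ≡ true ⊎ Past w i j′ ⊎ Past (opposite w) i j′ → Corner w high i j′
        finish (inj₁ t)        = contradiction (beside j′ t) (<-irrefl refl)
        finish (inj₂ (inj₁ p)) = p , beside
        finish (inj₂ (inj₂ p)) = contradiction (≤last j′) (corner-empty {h = high} (p , beside) tl l≼i)

      clause : ∀ L R {i j} → hside L ≡ low → hside R ≡ high →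
               toℕ k ≼[ opposite (vside L) ] toℕ i → toℕ l ≼[ opposite (vside R) ] toℕ i →
               ⟦ ¬ L [ pos i , pos j ] ⇒ R [ pos i , pos j + r i ] ⟧ valuation
      clause L R {i} {j} eL eR k≼i l≼i ¬ℓ = at-intro λ i′ j′ ei ej →
        case Fin.toℕ-injective (suc-injective ei) of λ where
          refl → mark R (subst (λ s → Corner (vside R) s i j′) (sym eR)
            (reach k≼i l≼i (suc-injective ej) λ c →
              ¬ℓ (at-pos (mark L (subst (λ s → Corner (vside L) s i j) (sym eL) c)) refl refl)))

theorem2 : (m n : ℕ) .{{_ : NonZero m}} .{{_ : NonZero n}}
    (r : Vector ℕ m) (c : Vector ℕ n) →
    (∀ i → r i > 0) → (∀ j → c j > 0) → sum r ≡ sum c →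
    (k l : Fin m) →
    Satisfiable (F k l r c) ⇔
    (∃ λ (T : Object m n) →
    IsRealization r c T × HVConvex T × IsPolyomino T × Anchored k l T)
theorem2 m n r c r>0 c>0 Σr≡Σc k l = mk⇔ realize satisfy
  where
  realize : Satisfiable (F k l r c) → ∃ λ (T : Object m n) →
            IsRealization r c T × HVConvex T × IsPolyomino T × Anchored k l T
  realize (ν , e) with eval⇒⟦⟧ (F k l r c) e
  ... | cor , _ , con , anc , lbc , ubr =
    T , (rows , columns) , (h-convex cor , v-convex cor)
      , overlaps⇒polyomino (v-convex cor) (λ ej → meet cor con ej column-nonempty)
        (k , proj₁ (anchored anc))
      , anchored anc
    where
    open FromValuation ν
    ΣT : sum (λ i → count (T i)) ≡ sum (λ j → count (λ i → T i j))
    ΣT = ∑-comm (λ i j → bit (T i j))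
    rows≤ : ∀ i → count (T i) ≤ r i
    rows≤ = row≤ cor {k} {l} {r} ubr
    columns≥ : ∀ j → c j ≤ count (λ i → T i j)
    columns≥ = column≥ cor {c} lbc
    rows : ∀ i → count (T i) ≡ r i
    rows = sum-squeeze rows≤
      (≤-trans (≤-reflexive Σr≡Σc) (≤-trans (sum-mono columns≥) (≤-reflexive (sym ΣT))))
    columns : ∀ j → count (λ i → T i j) ≡ c j
    columns j = sym (sum-squeeze columns≥
      (≤-trans (≤-reflexive (sym ΣT)) (≤-trans (sum-mono rows≤) (≤-reflexive Σr≡Σc))) j)
    column-nonempty : ∀ j → ∃ λ i → T i j ≡ true
    column-nonempty j = count>0⇒∃ (λ i → T i j) (subst (_> 0) (sym (columns j)) (c>0 j))

  satisfy : (∃ λ (T : Object m n) →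
            IsRealization r c T × HVConvex T × IsPolyomino T × Anchored k l T) →
            Satisfiable (F k l r c)
  satisfy (T , (rows , columns) , (h-convex , v-convex) , polyomino , anc) =
    valuation , ⟦⟧⇒eval (F k l r c)
      (Cor-holds , Dis-holds , Con-holds , Anc-holds anc
      , LBC-holds c>0 columns , UBR-holds h-convex v-convex anc rows)
    where
    open FromObject T
      (λ i → count>0⇒∃ (T i) (subst (_> 0) (sym (rows i)) (r>0 i)))
      (λ j → count>0⇒∃ (λ i → T i j) (subst (_> 0) (sym (columns j)) (c>0 j)))
      polyomino
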